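{- If $n$ is a positive integer and $t$ is any integer, then $$\sum_{k=0}^n(-1)^{n-k}\frac{n}{n+k}\binom{n+k}{n-k}L_{3k+t}=\begin{cases}\frac52F_tF_n,& n\text{ odd};\\ \frac12L_tL_n,& n\text{ even};\end{cases}$$ $$\sum_{k=0}^n(-1)^{n-k}\frac{n}{n+k}\binom{n+k}{n-k}F_{3k+t}=\begin{cases}\frac12L_tF_n,& n\text{ odd};\\ \frac12F_tL_n,& n\text{ even}.\end{cases}$$
   Context: $F_n$ and $L_n$ ($n\in\mathbb{Z}$) are the Fibonacci and Lucas numbers: $F_0=0$, $F_1=1$, $F_n=F_{n-1}+F_{n-2}$; $L_0=2$, $L_1=1$, $L_n=L_{n-1}+L_{n-2}$, extended to negative indices by $F_{ -n}=(-1)^{n-1}F_n$, $L_{ -n}=(-1)^nL_n$. -}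

module Defs where

open import Data.Nat.Base as ℕ using (ℕ; zero; suc; _∸_; NonZero)
open import Data.Nat.Combinatorics using (_C_)
open import Data.Integer.Base as ℤ using (ℤ; +_; -[1+_]; -1ℤ)
open import Data.Rational.Base using (ℚ; _/_; _*_)

fib : ℕ → ℕ
fib 0             = 0
fib 1             = 1
fib (suc (suc n)) = fib (suc n) ℕ.+ fib n

luc : ℕ → ℕ
luc 0             = 2
luc 1             = 1
luc (suc (suc n)) = luc (suc n) ℕ.+ luc n

-- F₋ₙ = (-1)ⁿ⁻¹ Fₙ; note that -[1+ m ] is -n with n = suc m.
F : ℤ → ℤ
F (+ n)    = + fib n
F -[1+ m ] = -1ℤ ℤ.^ m ℤ.* + fib (suc m)

-- L₋ₙ = (-1)ⁿ Lₙ
L : ℤ → ℤ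
L (+ n)    = + luc n
L -[1+ m ] = -1ℤ ℤ.^ suc m ℤ.* + luc (suc m)

infix 9 ↑_

↑_ : ℤ → ℚ
↑ i = i / 1

m+n≢0 : ∀ m n → .{{NonZero m}} → NonZero (m ℕ.+ n)
m+n≢0 (suc m) n = _

-- (-1)ⁿ⁻ᵏ · n/(n+k) · binom(n+k, n-k), intended for k ≤ n, where ∸ is exact.
-- It need not be an integer: for n = k = 1 it is 1/2.
coeff : (n : ℕ) .{{_ : NonZero n}} → ℕ → ℚ
coeff n k = ↑ (-1ℤ ℤ.^ (n ∸ k)) * n/[n+k] * ↑ (+ ((n ℕ.+ k) C (n ∸ k)))
  where
  n/[n+k] : ℚ
  n/[n+k] = _/_ (+ n) (n ℕ.+ k) {{m+n≢0 n k}}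

{-# OPTIONS --safe #-}
module Submission where

-- Twice the coefficient (-1)ⁿ⁻ᵏ n/(n+k) binom(n+k, n-k) is the integer
-- (-1)ⁿ⁻ᵏ (binom(n+k, 2k) + binom(n+k-1, 2k)), and these are the coefficients of
-- the polynomials with T₀ = 2, T₁ = x - 2, Tₙ₊₁ = (x - 2) Tₙ - Tₙ₋₁ (a consequence
-- of Pascal's rule). Let x act on sequences satisfying the Fibonacci recurrence
-- as the shift by 3. Then D = x - 2 sends G to 2 Gₜ₊₁ - Gₜ, which exchanges F and L
-- up to a factor: D F = L and D L = 5 F. Hence D² = 5 (D is the √5 of α³ = 2 + √5),
-- and induction gives Tₙ = Fₙ D for odd n and Tₙ = Lₙ for even n.

open import Defs
open import Data.Nat.Base using (ℕ; NonZero)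
open import Data.Nat.Divisibility using (_∣_; _∤_)
open import Data.Integer.Base as ℤ using (ℤ; +_)
open import Data.Rational.Base using (_/_; _*_; ½)
open import Data.Rational.Properties using (+-0-monoid)
open import Algebra.Properties.Monoid.Sum +-0-monoid using (sum⁺-syntax)
open import Data.Fin.Base using (toℕ)
open import Data.Product.Base using (_×_)
open import Relation.Binary.PropositionalEquality.Core using (_≡_)

open import Data.Nat.Base as ℕ using (zero; suc; _∸_; _≤_)
import Data.Nat.Properties as ℕ
open import Data.Nat.Combinatorics using
  (_C_; nCn≡1; nC1≡n; nCk≡nC[n∸k]; k>n⇒nCk≡0; nCk+nC[k+1]≡[n+1]C[k+1])
open import Data.Nat.Divisibility using (divides)
import Data.Nat.Tactic.RingSolver as ℕ-Ring
open import Data.Integer.Base using (-[1+_]; 0ℤ; 1ℤ; -1ℤ)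
import Data.Integer.Properties as ℤ
import Data.Integer.Tactic.RingSolver as ℤ-Ring
open import Algebra.Properties.Semiring.Sum ℤ.+-*-semiring as ℤ-Sum using (sum)
open import Data.Rational.Base as ℚ using (toℚᵘ)
import Data.Rational.Properties as ℚ
import Data.Rational.Unnormalised.Base as ℚᵘ
import Data.Rational.Unnormalised.Properties as ℚᵘ
import Algebra.Properties.Monoid.Sum +-0-monoid as ℚ-Sum
open import Algebra.Bundles using (CommutativeMonoid)
open import Algebra.Properties.CommutativeSemigroup
  (CommutativeMonoid.commutativeSemigroup ℚ.*-1-commutativeMonoid) using (x∙yz≈y∙xz)
open import Data.Fin.Base using (Fin)
open import Data.Fin.Properties using (toℕ≤pred[n])
open import Data.Product.Base using (_,_; proj₁; proj₂; ∃)
open import Data.Sum.Base using (_⊎_; inj₁; inj₂)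
open import Function.Base using (_∘_)
open import Relation.Nullary.Negation using (contradiction)
open import Relation.Binary.PropositionalEquality using
  (refl; sym; trans; cong; cong₂; subst; module ≡-Reasoning)

-- Binomial identities: clearing the denominator of the coefficient.

-- The absorption identity, by induction: Pascal's rule splits the left side, and again recombines
-- what the two induction hypotheses give.
[k+1]*[n+1]C[k+1]≡[n+1]*nCk : ∀ n k → suc k ℕ.* (suc n C suc k) ≡ suc n ℕ.* (n C k)
[k+1]*[n+1]C[k+1]≡[n+1]*nCk n       zero    =
  trans (ℕ.*-identityˡ _) (trans (nC1≡n (suc n)) (sym (ℕ.*-identityʳ _)))
[k+1]*[n+1]C[k+1]≡[n+1]*nCk zero    (suc k) = ℕ.*-zeroʳ k
[k+1]*[n+1]C[k+1]≡[n+1]*nCk (suc n) (suc k) = begin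
  suc (suc k) ℕ.* (suc (suc n) C suc (suc k))
    ≡⟨ cong (suc (suc k) ℕ.*_) (nCk+nC[k+1]≡[n+1]C[k+1] (suc n) (suc k)) ⟨
  suc (suc k) ℕ.* (c ℕ.+ (suc n C suc (suc k)))
    ≡⟨ ℕ.*-distribˡ-+ (suc (suc k)) c _ ⟩
  (c ℕ.+ suc k ℕ.* c) ℕ.+ suc (suc k) ℕ.* (suc n C suc (suc k))
    ≡⟨ cong₂ (λ x y → (c ℕ.+ x) ℕ.+ y)
         ([k+1]*[n+1]C[k+1]≡[n+1]*nCk n k) ([k+1]*[n+1]C[k+1]≡[n+1]*nCk n (suc k)) ⟩
  (c ℕ.+ suc n ℕ.* (n C k)) ℕ.+ suc n ℕ.* (n C suc k)
    ≡⟨ ℕ.+-assoc c _ _ ⟩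
  c ℕ.+ (suc n ℕ.* (n C k) ℕ.+ suc n ℕ.* (n C suc k))
    ≡⟨ cong (c ℕ.+_) (ℕ.*-distribˡ-+ (suc n) (n C k) _) ⟨
  c ℕ.+ suc n ℕ.* ((n C k) ℕ.+ (n C suc k))
    ≡⟨ cong (λ x → c ℕ.+ suc n ℕ.* x) (nCk+nC[k+1]≡[n+1]C[k+1] n k) ⟩
  suc (suc n) ℕ.* c ∎
  where
  open ≡-Reasoning
  c = suc n C suc k

[m+n]Cm≡[m+n]Cn : ∀ m n → (m ℕ.+ n) C m ≡ (m ℕ.+ n) C n
[m+n]Cm≡[m+n]Cn m n =
  trans (nCk≡nC[n∸k] (ℕ.m≤m+n m n)) (cong ((m ℕ.+ n) C_) (ℕ.m+n∸m≡n m n))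

-- Split 2d + j as (d + j) + d, absorb the factor d into the binomial, and use symmetry. It is meant
-- for d = n - k and j = 2k, where 2d + j = 2n and d + j = n + k.
[2d+j]*[d+j]Cd : ∀ d j .{{_ : NonZero (d ℕ.+ j)}} →
  (d ℕ.+ d ℕ.+ j) ℕ.* ((d ℕ.+ j) C d) ≡
  (d ℕ.+ j) ℕ.* (((d ℕ.+ j) C j) ℕ.+ (ℕ.pred (d ℕ.+ j) C j))
[2d+j]*[d+j]Cd zero    (suc j) = cong (suc j ℕ.*_) (sym (begin
  (suc j C suc j) ℕ.+ (j C suc j)
    ≡⟨ cong₂ ℕ._+_ (nCn≡1 (suc j)) (k>n⇒nCk≡0 (ℕ.n<1+n j)) ⟩
  1 ∎))
  where open ≡-Reasoning
[2d+j]*[d+j]Cd (suc d) j       = begin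
  (suc d ℕ.+ suc d ℕ.+ j) ℕ.* c
    ≡⟨ expand (suc d) j c ⟩
  (suc d ℕ.+ j) ℕ.* c ℕ.+ suc d ℕ.* c
    ≡⟨ cong ((suc d ℕ.+ j) ℕ.* c ℕ.+_) ([k+1]*[n+1]C[k+1]≡[n+1]*nCk (d ℕ.+ j) d) ⟩
  (suc d ℕ.+ j) ℕ.* c ℕ.+ (suc d ℕ.+ j) ℕ.* ((d ℕ.+ j) C d)
    ≡⟨ ℕ.*-distribˡ-+ (suc d ℕ.+ j) c _ ⟨
  (suc d ℕ.+ j) ℕ.* (c ℕ.+ ((d ℕ.+ j) C d))
    ≡⟨ cong₂ (λ x y → (suc d ℕ.+ j) ℕ.* (x ℕ.+ y))
         ([m+n]Cm≡[m+n]Cn (suc d) j) ([m+n]Cm≡[m+n]Cn d j) ⟩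
  (suc d ℕ.+ j) ℕ.* (((suc d ℕ.+ j) C j) ℕ.+ ((d ℕ.+ j) C j)) ∎
  where
  open ≡-Reasoning
  c = (suc d ℕ.+ j) C suc d
  expand : ∀ d j c → (d ℕ.+ d ℕ.+ j) ℕ.* c ≡ (d ℕ.+ j) ℕ.* c ℕ.+ d ℕ.* c
  expand = ℕ-Ring.solve-∀

2n*[n+k]C[n∸k] : ∀ m {k} → let n = suc m in k ≤ n →
  (n ℕ.+ n) ℕ.* ((n ℕ.+ k) C (n ∸ k)) ≡
  (n ℕ.+ k) ℕ.* (((n ℕ.+ k) C (k ℕ.+ k)) ℕ.+ ((m ℕ.+ k) C (k ℕ.+ k)))
2n*[n+k]C[n∸k] m {k} k≤n = begin
  (n ℕ.+ n) ℕ.* ((n ℕ.+ k) C d)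
    ≡⟨ cong (ℕ._* ((n ℕ.+ k) C d)) (trans (cong (λ x → x ℕ.+ x) n≡) (shuffle d k)) ⟩
  (d ℕ.+ d ℕ.+ (k ℕ.+ k)) ℕ.* ((n ℕ.+ k) C d)
    ≡⟨ main ⟩
  (n ℕ.+ k) ℕ.* (((n ℕ.+ k) C (k ℕ.+ k)) ℕ.+ ((m ℕ.+ k) C (k ℕ.+ k))) ∎
  where
  open ≡-Reasoning
  n = suc m
  d = n ∸ k
  n≡ : n ≡ d ℕ.+ k
  n≡ = sym (ℕ.m∸n+n≡m k≤n)
  n+k≡ : d ℕ.+ (k ℕ.+ k) ≡ n ℕ.+ k
  n+k≡ = trans (sym (ℕ.+-assoc d k k)) (cong (ℕ._+ k) (sym n≡))
  shuffle : ∀ d k → (d ℕ.+ k) ℕ.+ (d ℕ.+ k) ≡ d ℕ.+ d ℕ.+ (k ℕ.+ k)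
  shuffle = ℕ-Ring.solve-∀
  instance
    d+2k≢0 : NonZero (d ℕ.+ (k ℕ.+ k))
    d+2k≢0 = subst NonZero (sym n+k≡) _
  -- The transport is along the upper index `N`, so that `pred N` becomes `m + k` when `N` is
  -- `suc m + k`.
  main = subst
    (λ N → (d ℕ.+ d ℕ.+ (k ℕ.+ k)) ℕ.* (N C d) ≡
           N ℕ.* ((N C (k ℕ.+ k)) ℕ.+ (ℕ.pred N C (k ℕ.+ k))))
    n+k≡ ([2d+j]*[d+j]Cd d (k ℕ.+ k))

-- Binomial sums over even and odd lower indices, and their recurrences.

-- Both ends 0 and `n` are included. Summands are functions on all of ℕ, so that removing the first
-- term is composition with `suc`.
sumTo : ℕ → (ℕ → ℤ) → ℤ
sumTo n f = sum {suc n} (f ∘ toℕ)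

sumTo-cong : ∀ n {f g : ℕ → ℤ} → (∀ k → f k ≡ g k) → sumTo n f ≡ sumTo n g
sumTo-cong n f≗g = ℤ-Sum.sum-cong-≗ {suc n} (f≗g ∘ toℕ)

sumTo-last : ∀ n f → sumTo (suc n) f ≡ sumTo n f ℤ.+ f (suc n)
sumTo-last zero    f = swap (f 0) (f 1)
  where
  swap : ∀ x y → x ℤ.+ (y ℤ.+ 0ℤ) ≡ x ℤ.+ 0ℤ ℤ.+ y
  swap = ℤ-Ring.solve-∀
sumTo-last (suc n) f =
  trans (cong (ℤ._+_ (f 0)) (sumTo-last n (f ∘ suc))) (sym (ℤ.+-assoc (f 0) _ _))

-- The two Morgan-Voyce polynomials of index `n`, with `b k` in place of the k-th power of the
-- variable; multiplication by the variable is `b ∘ suc`.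
evenSum oddSum : ℕ → (ℕ → ℤ) → ℤ
evenSum n b = sumTo n (λ k → + ((n ℕ.+ k) C (k ℕ.+ k)) ℤ.* b k)
oddSum  n b = sumTo n (λ k → + ((n ℕ.+ suc k) C suc (k ℕ.+ k)) ℤ.* b k)

-- The extra coefficient binom(2n+1, 2n+2) vanishes. This aligns the ranges of sums belonging to
-- consecutive `n`.
evenSum-extend : ∀ n b →
  sumTo (suc n) (λ k → + ((n ℕ.+ k) C (k ℕ.+ k)) ℤ.* b k) ≡ evenSum n b
evenSum-extend n b = begin
  sumTo (suc n) f             ≡⟨ sumTo-last n f ⟩
  evenSum n b ℤ.+ f (suc n)   ≡⟨ cong (λ c → evenSum n b ℤ.+ + c ℤ.* b (suc n)) vanish ⟩
  evenSum n b ℤ.+ 0ℤ          ≡⟨ ℤ.+-identityʳ _ ⟩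
  evenSum n b                 ∎
  where
  open ≡-Reasoning
  f = λ k → + ((n ℕ.+ k) C (k ℕ.+ k)) ℤ.* b k
  vanish : (n ℕ.+ suc n) C (suc n ℕ.+ suc n) ≡ 0
  vanish = k>n⇒nCk≡0 (ℕ.n<1+n (n ℕ.+ suc n))

oddSum-extend : ∀ n b →
  sumTo (suc n) (λ k → + ((n ℕ.+ suc k) C suc (k ℕ.+ k)) ℤ.* b k) ≡ oddSum n b
oddSum-extend n b = begin
  sumTo (suc n) f             ≡⟨ sumTo-last n f ⟩
  oddSum n b ℤ.+ f (suc n)    ≡⟨ cong (λ c → oddSum n b ℤ.+ + c ℤ.* b (suc n)) vanish ⟩
  oddSum n b ℤ.+ 0ℤ           ≡⟨ ℤ.+-identityʳ _ ⟩
  oddSum n b                  ∎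
  where
  open ≡-Reasoning
  f = λ k → + ((n ℕ.+ suc k) C suc (k ℕ.+ k)) ℤ.* b k
  vanish : (n ℕ.+ suc (suc n)) C suc (suc n ℕ.+ suc n) ≡ 0
  vanish = k>n⇒nCk≡0 (subst (ℕ._< suc (suc n ℕ.+ suc n))
             (sym (ℕ.+-suc n (suc n))) (ℕ.n<1+n _))

pascal-* : ∀ n k x →
  + (suc n C suc k) ℤ.* x ≡ + (n C k) ℤ.* x ℤ.+ + (n C suc k) ℤ.* x
pascal-* n k x = begin
  + (suc n C suc k) ℤ.* x
    ≡⟨ cong (λ c → + c ℤ.* x) (nCk+nC[k+1]≡[n+1]C[k+1] n k) ⟨
  (+ (n C k) ℤ.+ + (n C suc k)) ℤ.* x
    ≡⟨ ℤ.*-distribʳ-+ x (+ (n C k)) (+ (n C suc k)) ⟩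
  + (n C k) ℤ.* x ℤ.+ + (n C suc k) ℤ.* x ∎
  where open ≡-Reasoning

sumTo-+ : ∀ n f g → sumTo n (λ k → f k ℤ.+ g k) ≡ sumTo n f ℤ.+ sumTo n g
sumTo-+ n f g = ℤ-Sum.∑-distrib-+ {suc n} (f ∘ toℕ) (g ∘ toℕ)

-- For positive lower index 2k, Pascal's rule produces the odd lower index 2k - 1; reindexing from k
-- = 1 shifts `b`.
evenSum-suc : ∀ n b → evenSum (suc n) b ≡ evenSum n b ℤ.+ oddSum n (b ∘ suc)
evenSum-suc n b = begin
  -- The first term may be written with `n` instead of `suc n`, since both binomials with lower
  -- index 0 compute to 1.
  f 0 ℤ.+ sumTo n (λ k → + ((suc n ℕ.+ suc k) C (suc k ℕ.+ suc k)) ℤ.* b (suc k))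
    ≡⟨ cong (ℤ._+_ (f 0)) (sumTo-cong n split) ⟩
  f 0 ℤ.+ sumTo n (λ k → g k ℤ.+ f (suc k))
    ≡⟨ cong (ℤ._+_ (f 0)) (sumTo-+ n g (f ∘ suc)) ⟩
  f 0 ℤ.+ (oddSum n (b ∘ suc) ℤ.+ sumTo n (f ∘ suc))
    ≡⟨ swap (f 0) (oddSum n (b ∘ suc)) _ ⟩
  sumTo (suc n) f ℤ.+ oddSum n (b ∘ suc)
    ≡⟨ cong (ℤ._+ oddSum n (b ∘ suc)) (evenSum-extend n b) ⟩
  evenSum n b ℤ.+ oddSum n (b ∘ suc) ∎
  where
  open ≡-Reasoning
  f g : ℕ → ℤ
  f k = + ((n ℕ.+ k) C (k ℕ.+ k)) ℤ.* b k
  g k = + ((n ℕ.+ suc k) C suc (k ℕ.+ k)) ℤ.* b (suc k)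
  split : ∀ k → + ((suc n ℕ.+ suc k) C (suc k ℕ.+ suc k)) ℤ.* b (suc k) ≡ g k ℤ.+ f (suc k)
  split k rewrite ℕ.+-suc k k = pascal-* (n ℕ.+ suc k) (suc (k ℕ.+ k)) (b (suc k))
  swap : ∀ x y z → x ℤ.+ (y ℤ.+ z) ≡ (x ℤ.+ z) ℤ.+ y
  swap = ℤ-Ring.solve-∀

oddSum-suc : ∀ n b → oddSum (suc n) b ≡ evenSum (suc n) b ℤ.+ oddSum n b
oddSum-suc n b = begin
  oddSum (suc n) b
    ≡⟨ sumTo-cong (suc n) split ⟩
  sumTo (suc n) (λ k → f k ℤ.+ g k)
    ≡⟨ sumTo-+ (suc n) f g ⟩
  evenSum (suc n) b ℤ.+ sumTo (suc n) g
    ≡⟨ cong (ℤ._+_ (evenSum (suc n) b)) (oddSum-extend n b) ⟩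
  evenSum (suc n) b ℤ.+ oddSum n b ∎
  where
  open ≡-Reasoning
  f g : ℕ → ℤ
  f k = + ((suc n ℕ.+ k) C (k ℕ.+ k)) ℤ.* b k
  g k = + ((n ℕ.+ suc k) C suc (k ℕ.+ k)) ℤ.* b k
  split : ∀ k → + ((suc n ℕ.+ suc k) C suc (k ℕ.+ k)) ℤ.* b k ≡ f k ℤ.+ g k
  split k rewrite ℕ.+-suc n k = pascal-* (suc n ℕ.+ k) (k ℕ.+ k) (b k)

-- Up to the sign (-1)ᵐ⁺¹, this is 2 ∑ coeff (m + 1) k a k, where b k = (-1)ᵏ a k.
trace : ℕ → (ℕ → ℤ) → ℤ
trace m b = evenSum (suc m) b ℤ.+ evenSum m b

-- Eliminate `oddSum` from the two one-step recurrences. The multiplier is 2 plus the shift of `b`;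
-- for `b k = (-1)ᵏ a k` it becomes 2 - x on `a`, and the sign (-1)ⁿ turns this into x - 2.
evenSum-rec : ∀ n b → evenSum (suc (suc n)) b ≡
  evenSum (suc n) b ℤ.+ evenSum (suc n) b ℤ.- evenSum n b ℤ.+ evenSum (suc n) (b ∘ suc)
evenSum-rec n b = begin
  evenSum (suc (suc n)) b
    ≡⟨ evenSum-suc (suc n) b ⟩
  evenSum (suc n) b ℤ.+ oddSum (suc n) b′
    ≡⟨ cong (ℤ._+_ (evenSum (suc n) b)) (oddSum-suc n b′) ⟩
  evenSum (suc n) b ℤ.+ (evenSum (suc n) b′ ℤ.+ oddSum n b′)
    ≡⟨ rearrange (evenSum (suc n) b) (evenSum (suc n) b′) (oddSum n b′) (evenSum n b) ⟩
  evenSum (suc n) b ℤ.+ (evenSum n b ℤ.+ oddSum n b′) ℤ.- evenSum n b ℤ.+ evenSum (suc n) b′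
    ≡⟨ cong (λ x → evenSum (suc n) b ℤ.+ x ℤ.- evenSum n b ℤ.+ evenSum (suc n) b′)
         (evenSum-suc n b) ⟨
  evenSum (suc n) b ℤ.+ evenSum (suc n) b ℤ.- evenSum n b ℤ.+ evenSum (suc n) b′ ∎
  where
  open ≡-Reasoning
  b′ = b ∘ suc
  rearrange : ∀ x y z w → x ℤ.+ (y ℤ.+ z) ≡ x ℤ.+ (w ℤ.+ z) ℤ.- w ℤ.+ y
  rearrange = ℤ-Ring.solve-∀

trace-rec : ∀ m b → trace (suc (suc m)) b ≡
  trace (suc m) b ℤ.+ trace (suc m) b ℤ.- trace m b ℤ.+ trace (suc m) (b ∘ suc)
trace-rec m b = trans
  (cong₂ ℤ._+_ (evenSum-rec (suc m) b) (evenSum-rec m b))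
  (rearrange (evenSum (suc (suc m)) b) (evenSum (suc m) b) (evenSum m b)
    (evenSum (suc (suc m)) (b ∘ suc)) (evenSum (suc m) (b ∘ suc)))
  where
  rearrange : ∀ x y z p q →
    (x ℤ.+ x ℤ.- y ℤ.+ p) ℤ.+ (y ℤ.+ y ℤ.- z ℤ.+ q) ≡
    (x ℤ.+ y) ℤ.+ (x ℤ.+ y) ℤ.- (y ℤ.+ z) ℤ.+ (p ℤ.+ q)
  rearrange = ℤ-Ring.solve-∀

-- Closed form of the trace, by induction over pairs of indices.

-- Both sides satisfy the Fibonacci recurrence and agree at two initial values. It passes between
-- the Fibonacci factor for odd index and the Lucas factor for even index.
luc[1+n]≡fib[n]+fib[2+n] : ∀ n → luc (suc n) ≡ fib n ℕ.+ fib (suc (suc n))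
luc[1+n]≡fib[n]+fib[2+n] zero          = refl
luc[1+n]≡fib[n]+fib[2+n] (suc zero)    = refl
luc[1+n]≡fib[n]+fib[2+n] (suc (suc n)) = trans
  (cong₂ ℕ._+_ (luc[1+n]≡fib[n]+fib[2+n] (suc n)) (luc[1+n]≡fib[n]+fib[2+n] n))
  (rearrange (fib n) (fib (suc n)))
  where
  rearrange : ∀ x y → (y ℕ.+ ((y ℕ.+ x) ℕ.+ y)) ℕ.+ (x ℕ.+ (y ℕ.+ x)) ≡
    (y ℕ.+ x) ℕ.+ (((y ℕ.+ x) ℕ.+ y) ℕ.+ (y ℕ.+ x))
  rearrange = ℕ-Ring.solve-∀

-- The hypothesis is aₖ₊₂ = 4 aₖ₊₁ + aₖ for a k = (-1)ᵏ b k; in the same way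
-- b 0 + b 0 + b 1 is -D a, with D = x - 2.
trace-closed : ∀ j b → (∀ k → b k ≡ b (suc (suc k)) ℤ.+ + 4 ℤ.* b (suc k)) →
  trace (j ℕ.* 2) b ≡ + fib (suc (j ℕ.* 2)) ℤ.* (b 0 ℤ.+ b 0 ℤ.+ b 1) ×
  trace (suc (j ℕ.* 2)) b ≡ + luc (suc (suc (j ℕ.* 2))) ℤ.* b 0
trace-closed zero    b rec = base₀ (b 0) (b 1) , (begin
  trace 1 b                                  ≡⟨ base₁ (b 0) (b 1) (b 2) ⟩
  + 2 ℤ.* b 0 ℤ.+ (b 2 ℤ.+ + 4 ℤ.* b 1)       ≡⟨ cong (ℤ._+_ (+ 2 ℤ.* b 0)) (rec 0) ⟨
  + 2 ℤ.* b 0 ℤ.+ b 0                         ≡⟨ triple (b 0) ⟩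
  + 3 ℤ.* b 0                                 ∎)
  where
  open ≡-Reasoning
  base₀ : ∀ x y → (+ 1 ℤ.* x ℤ.+ (+ 1 ℤ.* y ℤ.+ 0ℤ)) ℤ.+ (+ 1 ℤ.* x ℤ.+ 0ℤ) ≡
    + 1 ℤ.* (x ℤ.+ x ℤ.+ y)
  base₀ = ℤ-Ring.solve-∀
  base₁ : ∀ x y z →
    (+ 1 ℤ.* x ℤ.+ (+ 3 ℤ.* y ℤ.+ (+ 1 ℤ.* z ℤ.+ 0ℤ))) ℤ.+ (+ 1 ℤ.* x ℤ.+ (+ 1 ℤ.* y ℤ.+ 0ℤ)) ≡
    + 2 ℤ.* x ℤ.+ (z ℤ.+ + 4 ℤ.* y)
  base₁ = ℤ-Ring.solve-∀
  triple : ∀ x → + 2 ℤ.* x ℤ.+ x ≡ + 3 ℤ.* x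
  triple = ℤ-Ring.solve-∀
trace-closed (suc j) b rec = odd b rec , (begin
  trace (suc (suc n)) b
    ≡⟨ trace-rec n b ⟩
  trace (suc n) b ℤ.+ trace (suc n) b ℤ.- trace n b ℤ.+ trace (suc n) (b ∘ suc)
    ≡⟨ cong₂ ℤ._+_
         (cong₂ (λ x y → x ℤ.+ x ℤ.- y) (odd b rec) (proj₂ (trace-closed j b rec)))
         (odd (b ∘ suc) (rec ∘ suc)) ⟩
  f ℤ.* h ℤ.+ f ℤ.* h ℤ.- + luc (suc n) ℤ.* b 0 ℤ.+ f ℤ.* (b 1 ℤ.+ b 1 ℤ.+ b 2)
    ≡⟨ collect f (+ luc (suc n)) (b 0) (b 1) (b 2) ⟩
  -- This is D² = 5: the recurrence turns `b 2 + 4 b 1` into `b 0`, so the bracket is `5 b 0`. What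
  -- remains is 5 Fₘ - Lₘ₋₁ = Lₘ₊₁ with m = n + 2.
  f ℤ.* (+ 4 ℤ.* b 0 ℤ.+ (b 2 ℤ.+ + 4 ℤ.* b 1)) ℤ.- + luc (suc n) ℤ.* b 0
    ≡⟨ cong₂ (λ x y → f ℤ.* (+ 4 ℤ.* b 0 ℤ.+ x) ℤ.- + y ℤ.* b 0)
         (sym (rec 0)) (luc[1+n]≡fib[n]+fib[2+n] n) ⟩
  f ℤ.* (+ 4 ℤ.* b 0 ℤ.+ b 0) ℤ.- + (fib n ℕ.+ fib (suc (suc n))) ℤ.* b 0
    ≡⟨ final (+ fib (suc n)) (+ fib n) (b 0) ⟩
  + (fib (suc (suc n)) ℕ.+ fib (suc (suc (suc (suc n))))) ℤ.* b 0
    ≡⟨ cong (λ x → + x ℤ.* b 0) (luc[1+n]≡fib[n]+fib[2+n] (suc (suc n))) ⟨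
  + luc (suc (suc (suc n))) ℤ.* b 0 ∎)
  where
  open ≡-Reasoning
  n = suc (j ℕ.* 2)
  f = + fib (suc (suc n))
  h = b 0 ℤ.+ b 0 ℤ.+ b 1
  collect : ∀ f l x y z →
    f ℤ.* (x ℤ.+ x ℤ.+ y) ℤ.+ f ℤ.* (x ℤ.+ x ℤ.+ y) ℤ.- l ℤ.* x ℤ.+ f ℤ.* (y ℤ.+ y ℤ.+ z) ≡
    f ℤ.* (+ 4 ℤ.* x ℤ.+ (z ℤ.+ + 4 ℤ.* y)) ℤ.- l ℤ.* x
  collect = ℤ-Ring.solve-∀
  final : ∀ p q x →
    (p ℤ.+ q) ℤ.* (+ 4 ℤ.* x ℤ.+ x) ℤ.- (q ℤ.+ (p ℤ.+ q)) ℤ.* x ≡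
    ((p ℤ.+ q) ℤ.+ (((p ℤ.+ q) ℤ.+ p) ℤ.+ (p ℤ.+ q))) ℤ.* x
  final = ℤ-Ring.solve-∀
  -- General in `b`, because the even case needs it for `b` and for `b ∘ suc`.
  odd : ∀ b → (∀ k → b k ≡ b (suc (suc k)) ℤ.+ + 4 ℤ.* b (suc k)) →
    trace (suc n) b ≡ + fib (suc (suc n)) ℤ.* (b 0 ℤ.+ b 0 ℤ.+ b 1)
  odd b rec = begin
    trace (suc n) b
      ≡⟨ trace-rec (j ℕ.* 2) b ⟩
    trace n b ℤ.+ trace n b ℤ.- trace (j ℕ.* 2) b ℤ.+ trace n (b ∘ suc)
      ≡⟨ cong₂ ℤ._+_
           (cong₂ (λ x y → x ℤ.+ x ℤ.- y) (proj₂ (trace-closed j b rec)) (proj₁ (trace-closed j b rec)))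
           (proj₂ (trace-closed j (b ∘ suc) (rec ∘ suc))) ⟩
    l ℤ.* b 0 ℤ.+ l ℤ.* b 0 ℤ.- + fib n ℤ.* h′ ℤ.+ l ℤ.* b 1
      ≡⟨ collect′ l (+ fib n) (b 0) (b 1) ⟩
    (l ℤ.- + fib n) ℤ.* h′
      ≡⟨ cong (λ x → (+ x ℤ.- + fib n) ℤ.* h′) (luc[1+n]≡fib[n]+fib[2+n] n) ⟩
    (+ fib n ℤ.+ + fib (suc (suc n)) ℤ.- + fib n) ℤ.* h′
      ≡⟨ cong (ℤ._* h′) (cancel (+ fib n) (+ fib (suc (suc n)))) ⟩
    + fib (suc (suc n)) ℤ.* h′ ∎
    where
    l = + luc (suc n)
    h′ = b 0 ℤ.+ b 0 ℤ.+ b 1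
    collect′ : ∀ l f x y → l ℤ.* x ℤ.+ l ℤ.* x ℤ.- f ℤ.* (x ℤ.+ x ℤ.+ y) ℤ.+ l ℤ.* y ≡
      (l ℤ.- f) ℤ.* (x ℤ.+ x ℤ.+ y)
    collect′ = ℤ-Ring.solve-∀
    cancel : ∀ x y → x ℤ.+ y ℤ.- x ≡ y
    cancel = ℤ-Ring.solve-∀

-- Signs, and passage from rational to integer sums.

-1^[m*2]≡1 : ∀ m → -1ℤ ℤ.^ (m ℕ.* 2) ≡ 1ℤ
-1^[m*2]≡1 zero    = refl
-1^[m*2]≡1 (suc m) rewrite -1^[m*2]≡1 m = refl

-1^[m+m]≡1 : ∀ m → -1ℤ ℤ.^ (m ℕ.+ m) ≡ 1ℤ
-1^[m+m]≡1 m = trans (cong (-1ℤ ℤ.^_) (double m)) (-1^[m*2]≡1 m)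
  where
  double : ∀ m → m ℕ.+ m ≡ m ℕ.* 2
  double = ℕ-Ring.solve-∀

-- Multiplying by (-1)²ᵏ = 1 replaces n - k by n + k. The part depending on n then leaves the sum.
-1^[n∸k]≡-1^n*-1^k : ∀ {n k} → k ≤ n → -1ℤ ℤ.^ (n ∸ k) ≡ -1ℤ ℤ.^ n ℤ.* -1ℤ ℤ.^ k
-1^[n∸k]≡-1^n*-1^k {n} {k} k≤n = begin
  -1ℤ ℤ.^ (n ∸ k)                               ≡⟨ ℤ.*-identityʳ _ ⟨
  -1ℤ ℤ.^ (n ∸ k) ℤ.* 1ℤ                        ≡⟨ cong (-1ℤ ℤ.^ (n ∸ k) ℤ.*_) (-1^[m+m]≡1 k) ⟨
  -1ℤ ℤ.^ (n ∸ k) ℤ.* -1ℤ ℤ.^ (k ℕ.+ k)         ≡⟨ ℤ.^-distribˡ-+-* -1ℤ (n ∸ k) (k ℕ.+ k) ⟨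
  -1ℤ ℤ.^ (n ∸ k ℕ.+ (k ℕ.+ k))                 ≡⟨ cong (-1ℤ ℤ.^_) (ℕ.+-assoc (n ∸ k) k k) ⟨
  -1ℤ ℤ.^ (n ∸ k ℕ.+ k ℕ.+ k)                   ≡⟨ cong (λ m → -1ℤ ℤ.^ (m ℕ.+ k)) (ℕ.m∸n+n≡m k≤n) ⟩
  -1ℤ ℤ.^ (n ℕ.+ k)                             ≡⟨ ℤ.^-distribˡ-+-* -1ℤ n k ⟩
  -1ℤ ℤ.^ n ℤ.* -1ℤ ℤ.^ k                       ∎
  where open ≡-Reasoning

-- Since `_/_` reduces to lowest terms, identities are checked on unnormalised fractions, where
-- cross-multiplication suffices.
toℚᵘ-/ : ∀ i n .{{_ : NonZero n}} → toℚᵘ (i / n) ℚᵘ.≃ i ℚᵘ./ n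
toℚᵘ-/ i n@(suc _) = ℚ.toℚᵘ-fromℚᵘ (i ℚᵘ./ n)

↑-* : ∀ i j → ↑ (i ℤ.* j) ≡ ↑ i * ↑ j
↑-* i j = ℚ.toℚᵘ-injective (begin
  toℚᵘ (↑ (i ℤ.* j))            ≈⟨ toℚᵘ-/ (i ℤ.* j) 1 ⟩
  i ℚᵘ./ 1 ℚᵘ.* (j ℚᵘ./ 1)      ≈⟨ ℚᵘ.*-cong (toℚᵘ-/ i 1) (toℚᵘ-/ j 1) ⟨
  toℚᵘ (↑ i) ℚᵘ.* toℚᵘ (↑ j)    ≈⟨ ℚ.toℚᵘ-homo-* (↑ i) (↑ j) ⟨
  toℚᵘ (↑ i * ↑ j)              ∎)
  where open ℚᵘ.≃-Reasoning

↑-+ : ∀ i j → ↑ (i ℤ.+ j) ≡ ↑ i ℚ.+ ↑ j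
↑-+ i j = ℚ.toℚᵘ-injective (begin
  toℚᵘ (↑ (i ℤ.+ j))            ≈⟨ toℚᵘ-/ (i ℤ.+ j) 1 ⟩
  (i ℤ.+ j) ℚᵘ./ 1              ≡⟨ cong (ℚᵘ._/ 1) (cong₂ ℤ._+_ (sym (ℤ.*-identityʳ i)) (sym (ℤ.*-identityʳ j))) ⟩
  i ℚᵘ./ 1 ℚᵘ.+ (j ℚᵘ./ 1)      ≈⟨ ℚᵘ.+-cong (toℚᵘ-/ i 1) (toℚᵘ-/ j 1) ⟨
  toℚᵘ (↑ i) ℚᵘ.+ toℚᵘ (↑ j)    ≈⟨ ℚ.toℚᵘ-homo-+ (↑ i) (↑ j) ⟨
  toℚᵘ (↑ i ℚ.+ ↑ j)            ∎)
  where open ℚᵘ.≃-Reasoning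

/*↑≡½*↑ : ∀ a b c d .{{_ : NonZero b}} → (a ℕ.+ a) ℕ.* c ≡ b ℕ.* d →
  (+ a / b) * ↑ (+ c) ≡ ½ * ↑ (+ d)
/*↑≡½*↑ a b@(suc b-1) c d eq = ℚ.toℚᵘ-injective (begin
  toℚᵘ ((+ a / b) * ↑ (+ c))          ≈⟨ ℚ.toℚᵘ-homo-* (+ a / b) (↑ (+ c)) ⟩
  toℚᵘ (+ a / b) ℚᵘ.* toℚᵘ (↑ (+ c))  ≈⟨ ℚᵘ.*-cong (toℚᵘ-/ (+ a) b) (toℚᵘ-/ (+ c) 1) ⟩
  (+ a ℚᵘ./ b) ℚᵘ.* (+ c ℚᵘ./ 1)      ≈⟨ ℚᵘ.*≡* cross ⟩
  ℚᵘ.½ ℚᵘ.* (+ d ℚᵘ./ 1)              ≈⟨ ℚᵘ.*-congˡ {ℚᵘ.½} (toℚᵘ-/ (+ d) 1) ⟨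
  ℚᵘ.½ ℚᵘ.* toℚᵘ (↑ (+ d))            ≈⟨ ℚ.toℚᵘ-homo-* ½ (↑ (+ d)) ⟨
  toℚᵘ (½ * ↑ (+ d))                  ∎)
  where
  open ℚᵘ.≃-Reasoning
  double : ∀ a c → (a ℤ.* c) ℤ.* + 2 ≡ (a ℤ.+ a) ℤ.* c
  double = ℤ-Ring.solve-∀
  unit : ∀ b d → b ℤ.* d ≡ (+ 1 ℤ.* d) ℤ.* (b ℤ.* + 1)
  unit = ℤ-Ring.solve-∀
  cross : (+ a ℤ.* + c) ℤ.* + 2 ≡ (+ 1 ℤ.* + d) ℤ.* + (b ℕ.* 1)
  cross = trans (double (+ a) (+ c)) (trans (sym (ℤ.pos-* (a ℕ.+ a) c))
    (trans (cong +_ eq) (trans (ℤ.pos-* b d) (trans (unit (+ b) (+ d))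
      (cong ((+ 1 ℤ.* + d) ℤ.*_) (sym (ℤ.pos-* b 1)))))))

½*↑-sum : ∀ n (f : Fin n → ℤ) → ℚ-Sum.sum (λ k → ½ * ↑ f k) ≡ ½ * ↑ sum f
½*↑-sum zero    f = refl
½*↑-sum (suc n) f = begin
  ½ * ↑ f₀ ℚ.+ ℚ-Sum.sum (λ k → ½ * ↑ f (Fin.suc k)) ≡⟨ cong (ℚ._+_ (½ * ↑ f₀)) (½*↑-sum n (f ∘ Fin.suc)) ⟩
  ½ * ↑ f₀ ℚ.+ ½ * ↑ rest                            ≡⟨ ℚ.*-distribˡ-+ ½ (↑ f₀) (↑ rest) ⟨
  ½ * (↑ f₀ ℚ.+ ↑ rest)                              ≡⟨ cong (½ *_) (↑-+ f₀ rest) ⟨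
  ½ * ↑ (f₀ ℤ.+ rest)                                ∎
  where
  open ≡-Reasoning
  f₀ = f Fin.zero
  rest = sum (f ∘ Fin.suc)

-- Moving (-1)ᵏ into the sequence leaves natural numbers as coefficients, so Pascal's rule applies
-- without signs.
alternate : (ℕ → ℤ) → ℕ → ℤ
alternate a k = -1ℤ ℤ.^ k ℤ.* a k

coeff*↑ : ∀ m {k} x → let n = suc m in k ≤ n →
  coeff n k * ↑ x ≡
  ½ * ↑ (-1ℤ ℤ.^ n ℤ.*
    (+ ((n ℕ.+ k) C (k ℕ.+ k)) ℤ.* (-1ℤ ℤ.^ k ℤ.* x) ℤ.+
     + ((m ℕ.+ k) C (k ℕ.+ k)) ℤ.* (-1ℤ ℤ.^ k ℤ.* x)))
coeff*↑ m {k} x k≤n = begin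
  ↑ s * (+ n / (n ℕ.+ k)) * ↑ (+ ((n ℕ.+ k) C (n ∸ k))) * ↑ x
    ≡⟨ cong (_* ↑ x) (ℚ.*-assoc (↑ s) (+ n / (n ℕ.+ k)) (↑ (+ ((n ℕ.+ k) C (n ∸ k))))) ⟩
  ↑ s * ((+ n / (n ℕ.+ k)) * ↑ (+ ((n ℕ.+ k) C (n ∸ k)))) * ↑ x
    ≡⟨ cong (λ q → ↑ s * q * ↑ x)
         (/*↑≡½*↑ n (n ℕ.+ k) ((n ℕ.+ k) C (n ∸ k)) (c₁ ℕ.+ c₂) (2n*[n+k]C[n∸k] m k≤n)) ⟩
  ↑ s * (½ * ↑ (+ (c₁ ℕ.+ c₂))) * ↑ x
    ≡⟨ cong (_* ↑ x) (x∙yz≈y∙xz (↑ s) ½ (↑ (+ (c₁ ℕ.+ c₂)))) ⟩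
  ½ * (↑ s * ↑ (+ (c₁ ℕ.+ c₂))) * ↑ x
    ≡⟨ ℚ.*-assoc ½ (↑ s * ↑ (+ (c₁ ℕ.+ c₂))) (↑ x) ⟩
  ½ * (↑ s * ↑ (+ (c₁ ℕ.+ c₂)) * ↑ x)
    ≡⟨ cong (λ q → ½ * (q * ↑ x)) (↑-* s (+ (c₁ ℕ.+ c₂))) ⟨
  ½ * (↑ (s ℤ.* + (c₁ ℕ.+ c₂)) * ↑ x)
    ≡⟨ cong (½ *_) (↑-* (s ℤ.* + (c₁ ℕ.+ c₂)) x) ⟨
  ½ * ↑ (s ℤ.* + (c₁ ℕ.+ c₂) ℤ.* x)
    ≡⟨ cong (λ i → ½ * ↑ (i ℤ.* + (c₁ ℕ.+ c₂) ℤ.* x)) (-1^[n∸k]≡-1^n*-1^k k≤n) ⟩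
  ½ * ↑ (-1ℤ ℤ.^ n ℤ.* -1ℤ ℤ.^ k ℤ.* + (c₁ ℕ.+ c₂) ℤ.* x)
    ≡⟨ cong (λ i → ½ * ↑ i) (distribute (-1ℤ ℤ.^ n) (-1ℤ ℤ.^ k) (+ c₁) (+ c₂) x) ⟩
  ½ * ↑ (-1ℤ ℤ.^ n ℤ.* (+ c₁ ℤ.* (-1ℤ ℤ.^ k ℤ.* x) ℤ.+ + c₂ ℤ.* (-1ℤ ℤ.^ k ℤ.* x))) ∎
  where
  open ≡-Reasoning
  n = suc m
  s = -1ℤ ℤ.^ (n ∸ k)
  c₁ = (n ℕ.+ k) C (k ℕ.+ k)
  c₂ = (m ℕ.+ k) C (k ℕ.+ k)
  distribute : ∀ p q y z x → p ℤ.* q ℤ.* (y ℤ.+ z) ℤ.* x ≡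
    p ℤ.* (y ℤ.* (q ℤ.* x) ℤ.+ z ℤ.* (q ℤ.* x))
  distribute = ℤ-Ring.solve-∀

∑-coeff : ∀ m (a : ℕ → ℤ) → let n = suc m in
  ∑[ k ≤ n ] (coeff n (toℕ k) * ↑ a (toℕ k)) ≡ ½ * ↑ (-1ℤ ℤ.^ n ℤ.* trace m (alternate a))
∑-coeff m a = begin
  ∑[ k ≤ n ] (coeff n (toℕ k) * ↑ a (toℕ k))
    ≡⟨ ℚ-Sum.sum-cong-≗ {suc n} (λ k → coeff*↑ m (a (toℕ k)) (toℕ≤pred[n] k)) ⟩
  ∑[ k ≤ n ] (½ * ↑ (s ℤ.* (f (toℕ k) ℤ.+ g (toℕ k))))
    ≡⟨ ½*↑-sum (suc n) (λ k → s ℤ.* (f (toℕ k) ℤ.+ g (toℕ k))) ⟩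
  ½ * ↑ sumTo n (λ k → s ℤ.* (f k ℤ.+ g k))
    ≡⟨ cong (λ i → ½ * ↑ i) (ℤ-Sum.*-distribˡ-sum {suc n} s (λ k → f (toℕ k) ℤ.+ g (toℕ k))) ⟨
  ½ * ↑ (s ℤ.* sumTo n (λ k → f k ℤ.+ g k))
    ≡⟨ cong (λ i → ½ * ↑ (s ℤ.* i)) (sumTo-+ n f g) ⟩
  -- The second sum runs one index past the range of `evenSum m b`, where its binomial vanishes.
  ½ * ↑ (s ℤ.* (evenSum n b ℤ.+ sumTo n g))
    ≡⟨ cong (λ i → ½ * ↑ (s ℤ.* (evenSum n b ℤ.+ i))) (evenSum-extend m b) ⟩
  ½ * ↑ (s ℤ.* trace m b) ∎
  where
  open ≡-Reasoning
  n = suc m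
  s = -1ℤ ℤ.^ n
  b = alternate a
  f g : ℕ → ℤ
  f k = + ((n ℕ.+ k) C (k ℕ.+ k)) ℤ.* b k
  g k = + ((m ℕ.+ k) C (k ℕ.+ k)) ℤ.* b k

-- Sequences on ℤ with the Fibonacci recurrence, and their shift by 3.

-- Shifts are written `1ℤ + t` since this computes on each constructor form of `t`.
FibonacciLike : (ℤ → ℤ) → Set
FibonacciLike G = ∀ t → G (1ℤ ℤ.+ (1ℤ ℤ.+ t)) ≡ G (1ℤ ℤ.+ t) ℤ.+ G t

F-fibonacciLike : FibonacciLike F
F-fibonacciLike (+ n)              = refl
-- At t = -1 and t = -2 the recurrence reaches non-negative indices; below that all three indices
-- are negative.
F-fibonacciLike -[1+ 0 ]           = refl
F-fibonacciLike -[1+ 1 ]           = refl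
F-fibonacciLike -[1+ suc (suc m) ] =
  alternating (-1ℤ ℤ.^ m) (+ fib (suc m)) (+ fib (suc (suc m)))
  where
  alternating : ∀ s x y → s ℤ.* x ≡ -1ℤ ℤ.* s ℤ.* y ℤ.+ -1ℤ ℤ.* (-1ℤ ℤ.* s) ℤ.* (y ℤ.+ x)
  alternating = ℤ-Ring.solve-∀

L-fibonacciLike : FibonacciLike L
L-fibonacciLike (+ n)              = refl
L-fibonacciLike -[1+ 0 ]           = refl
L-fibonacciLike -[1+ 1 ]           = refl
L-fibonacciLike -[1+ suc (suc m) ] =
  alternating (-1ℤ ℤ.^ suc m) (+ luc (suc m)) (+ luc (suc (suc m)))
  where
  alternating : ∀ s x y → s ℤ.* x ≡ -1ℤ ℤ.* s ℤ.* y ℤ.+ -1ℤ ℤ.* (-1ℤ ℤ.* s) ℤ.* (y ℤ.+ x)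
  alternating = ℤ-Ring.solve-∀

-- The relation D F = L.
2F[1+t]-F[t]≡L[t] : ∀ t → F (1ℤ ℤ.+ t) ℤ.+ F (1ℤ ℤ.+ t) ℤ.- F t ≡ L t
2F[1+t]-F[t]≡L[t] (+ zero)        = refl
2F[1+t]-F[t]≡L[t] (+ suc n)       = trans
  (rearrange (+ fib n) (+ fib (suc n)))
  (cong +_ (sym (luc[1+n]≡fib[n]+fib[2+n] n)))
  where
  rearrange : ∀ x y → (y ℤ.+ x) ℤ.+ (y ℤ.+ x) ℤ.- y ≡ x ℤ.+ (y ℤ.+ x)
  rearrange = ℤ-Ring.solve-∀
2F[1+t]-F[t]≡L[t] -[1+ zero ]     = refl
2F[1+t]-F[t]≡L[t] -[1+ suc m ]    = trans
  (rearrange (-1ℤ ℤ.^ m) (+ fib (suc m)) (+ fib (suc (suc m))))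
  (cong (λ l → -1ℤ ℤ.^ suc (suc m) ℤ.* + l) (sym (luc[1+n]≡fib[n]+fib[2+n] (suc m))))
  where
  rearrange : ∀ s x y → s ℤ.* x ℤ.+ s ℤ.* x ℤ.- -1ℤ ℤ.* s ℤ.* y ≡
    -1ℤ ℤ.* (-1ℤ ℤ.* s) ℤ.* (x ℤ.+ (y ℤ.+ x))
  rearrange = ℤ-Ring.solve-∀

-- The relation D L = 5 F: write L as D F and evaluate D² F by the recurrence.
2L[1+t]-L[t]≡5F[t] : ∀ t → L (1ℤ ℤ.+ t) ℤ.+ L (1ℤ ℤ.+ t) ℤ.- L t ≡ + 5 ℤ.* F t
2L[1+t]-L[t]≡5F[t] t = begin
  L t₁ ℤ.+ L t₁ ℤ.- L t
    ≡⟨ cong₂ (λ x y → x ℤ.+ x ℤ.- y) (2F[1+t]-F[t]≡L[t] t₁) (2F[1+t]-F[t]≡L[t] t) ⟨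
  l₁ ℤ.+ l₁ ℤ.- (F t₁ ℤ.+ F t₁ ℤ.- F t)
    ≡⟨ cong (λ x → (x ℤ.+ x ℤ.- F t₁) ℤ.+ (x ℤ.+ x ℤ.- F t₁) ℤ.- (F t₁ ℤ.+ F t₁ ℤ.- F t))
         (F-fibonacciLike t) ⟩
  (f₂ ℤ.+ f₂ ℤ.- F t₁) ℤ.+ (f₂ ℤ.+ f₂ ℤ.- F t₁) ℤ.- (F t₁ ℤ.+ F t₁ ℤ.- F t)
    ≡⟨ collect (F t) (F t₁) ⟩
  + 5 ℤ.* F t ∎
  where
  open ≡-Reasoning
  t₁ = 1ℤ ℤ.+ t
  l₁ = F (1ℤ ℤ.+ t₁) ℤ.+ F (1ℤ ℤ.+ t₁) ℤ.- F t₁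
  f₂ = F t₁ ℤ.+ F t
  collect : ∀ x y →
    ((y ℤ.+ x) ℤ.+ (y ℤ.+ x) ℤ.- y) ℤ.+ ((y ℤ.+ x) ℤ.+ (y ℤ.+ x) ℤ.- y) ℤ.- (y ℤ.+ y ℤ.- x) ≡
    + 5 ℤ.* x
  collect = ℤ-Ring.solve-∀

module _ (G : ℤ → ℤ) (G-fib : FibonacciLike G) where

  -- Subtracting 2 Gₜ gives the formula 2 Gₜ₊₁ - Gₜ for D = x - 2.
  G[3+t] : ∀ t → G (+ 3 ℤ.+ t) ≡ G (1ℤ ℤ.+ t) ℤ.+ G (1ℤ ℤ.+ t) ℤ.+ G t
  G[3+t] t = begin
    G (+ 3 ℤ.+ t)                                 ≡⟨ cong G (split t) ⟩
    G (1ℤ ℤ.+ (1ℤ ℤ.+ (1ℤ ℤ.+ t)))                ≡⟨ G-fib (1ℤ ℤ.+ t) ⟩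
    G (1ℤ ℤ.+ (1ℤ ℤ.+ t)) ℤ.+ G (1ℤ ℤ.+ t)        ≡⟨ cong (ℤ._+ G (1ℤ ℤ.+ t)) (G-fib t) ⟩
    G (1ℤ ℤ.+ t) ℤ.+ G t ℤ.+ G (1ℤ ℤ.+ t)         ≡⟨ swap (G (1ℤ ℤ.+ t)) (G t) ⟩
    G (1ℤ ℤ.+ t) ℤ.+ G (1ℤ ℤ.+ t) ℤ.+ G t         ∎
    where
    open ≡-Reasoning
    split : ∀ t → + 3 ℤ.+ t ≡ 1ℤ ℤ.+ (1ℤ ℤ.+ (1ℤ ℤ.+ t))
    split = ℤ-Ring.solve-∀
    swap : ∀ x y → x ℤ.+ y ℤ.+ x ≡ x ℤ.+ x ℤ.+ y
    swap = ℤ-Ring.solve-∀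

  -- The relation x² = 4x + 1, equivalent to (x - 2)² = 5, which the cubes of both roots of z² = z +
  -- 1 satisfy.
  G[6+t] : ∀ t → G (+ 3 ℤ.+ (+ 3 ℤ.+ t)) ≡ + 4 ℤ.* G (+ 3 ℤ.+ t) ℤ.+ G t
  G[6+t] t = begin
    G (+ 3 ℤ.+ (+ 3 ℤ.+ t))
      ≡⟨ G[3+t] (+ 3 ℤ.+ t) ⟩
    G (1ℤ ℤ.+ (+ 3 ℤ.+ t)) ℤ.+ G (1ℤ ℤ.+ (+ 3 ℤ.+ t)) ℤ.+ G (+ 3 ℤ.+ t)
      ≡⟨ cong₂ (λ x y → x ℤ.+ x ℤ.+ y)
           (trans (cong G (swap t)) (G[3+t] (1ℤ ℤ.+ t))) (G[3+t] t) ⟩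
    (g₂ ℤ.+ g₂ ℤ.+ g₁) ℤ.+ (g₂ ℤ.+ g₂ ℤ.+ g₁) ℤ.+ (g₁ ℤ.+ g₁ ℤ.+ g₀)
      ≡⟨ cong (λ x → (x ℤ.+ x ℤ.+ g₁) ℤ.+ (x ℤ.+ x ℤ.+ g₁) ℤ.+ (g₁ ℤ.+ g₁ ℤ.+ g₀)) (G-fib t) ⟩
    _
      ≡⟨ collect g₀ g₁ ⟩
    + 4 ℤ.* (g₁ ℤ.+ g₁ ℤ.+ g₀) ℤ.+ g₀
      ≡⟨ cong (λ x → + 4 ℤ.* x ℤ.+ g₀) (G[3+t] t) ⟨
    + 4 ℤ.* G (+ 3 ℤ.+ t) ℤ.+ g₀ ∎
    where
    open ≡-Reasoning
    g₀ = G t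
    g₁ = G (1ℤ ℤ.+ t)
    g₂ = G (1ℤ ℤ.+ (1ℤ ℤ.+ t))
    swap : ∀ t → 1ℤ ℤ.+ (+ 3 ℤ.+ t) ≡ + 3 ℤ.+ (1ℤ ℤ.+ t)
    swap = ℤ-Ring.solve-∀
    collect : ∀ x y →
      ((y ℤ.+ x) ℤ.+ (y ℤ.+ x) ℤ.+ y) ℤ.+ ((y ℤ.+ x) ℤ.+ (y ℤ.+ x) ℤ.+ y) ℤ.+ (y ℤ.+ y ℤ.+ x) ≡
      + 4 ℤ.* (y ℤ.+ y ℤ.+ x) ℤ.+ x
    collect = ℤ-Ring.solve-∀

  module _ (t : ℤ) where

    everyThird : ℕ → ℤ
    everyThird k = G (+ 3 ℤ.* + k ℤ.+ t)

    3[1+k]+t : ∀ k → + 3 ℤ.* + suc k ℤ.+ t ≡ + 3 ℤ.+ (+ 3 ℤ.* + k ℤ.+ t)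
    3[1+k]+t k = shift (+ k) t
      where
      shift : ∀ k t → + 3 ℤ.* (1ℤ ℤ.+ k) ℤ.+ t ≡ + 3 ℤ.+ (+ 3 ℤ.* k ℤ.+ t)
      shift = ℤ-Ring.solve-∀

    everyThird-suc : ∀ k → everyThird (suc k) ≡ G (+ 3 ℤ.+ (+ 3 ℤ.* + k ℤ.+ t))
    everyThird-suc k = cong G (3[1+k]+t k)

    everyThird-rec : ∀ k →
      everyThird (suc (suc k)) ≡ + 4 ℤ.* everyThird (suc k) ℤ.+ everyThird k
    everyThird-rec k = begin
      everyThird (suc (suc k))
        ≡⟨ everyThird-suc (suc k) ⟩
      G (+ 3 ℤ.+ (+ 3 ℤ.* + suc k ℤ.+ t))
        ≡⟨ cong (λ x → G (+ 3 ℤ.+ x)) (3[1+k]+t k) ⟩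
      G (+ 3 ℤ.+ (+ 3 ℤ.+ (+ 3 ℤ.* + k ℤ.+ t)))
        ≡⟨ G[6+t] (+ 3 ℤ.* + k ℤ.+ t) ⟩
      + 4 ℤ.* G (+ 3 ℤ.+ (+ 3 ℤ.* + k ℤ.+ t)) ℤ.+ everyThird k
        ≡⟨ cong (λ x → + 4 ℤ.* x ℤ.+ everyThird k) (everyThird-suc k) ⟨
      + 4 ℤ.* everyThird (suc k) ℤ.+ everyThird k ∎
      where open ≡-Reasoning

    -- The sign (-1)ᵏ changes 4 into -4 in the recurrence; solved for the lowest term, it is the
    -- hypothesis of `trace-closed`.
    alternate-rec : ∀ k → alternate everyThird k ≡
      alternate everyThird (suc (suc k)) ℤ.+ + 4 ℤ.* alternate everyThird (suc k)
    alternate-rec k = begin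
      p ℤ.* x₀
        ≡⟨ expand p x₀ x₁ ⟩
      -1ℤ ℤ.* (-1ℤ ℤ.* p) ℤ.* (+ 4 ℤ.* x₁ ℤ.+ x₀) ℤ.+ + 4 ℤ.* (-1ℤ ℤ.* p ℤ.* x₁)
        ≡⟨ cong (λ x → -1ℤ ℤ.* (-1ℤ ℤ.* p) ℤ.* x ℤ.+ + 4 ℤ.* (-1ℤ ℤ.* p ℤ.* x₁))
             (everyThird-rec k) ⟨
      alternate everyThird (suc (suc k)) ℤ.+ + 4 ℤ.* alternate everyThird (suc k) ∎
      where
      open ≡-Reasoning
      p = -1ℤ ℤ.^ k
      x₀ = everyThird k
      x₁ = everyThird (suc k)
      expand : ∀ p x y → p ℤ.* x ≡
        -1ℤ ℤ.* (-1ℤ ℤ.* p) ℤ.* (+ 4 ℤ.* y ℤ.+ x) ℤ.+ + 4 ℤ.* (-1ℤ ℤ.* p ℤ.* y)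
      expand = ℤ-Ring.solve-∀

    everyThird-zero : everyThird 0 ≡ G t
    everyThird-zero = cong G (ℤ.+-identityˡ t)

    -- The case Tₙ = Fₙ D, for arbitrary `G`, so that it serves both F and L.
    ∑-coeff-odd : ∀ j → let n = suc (j ℕ.* 2) in
      ∑[ k ≤ n ] (coeff n (toℕ k) * ↑ G (+ 3 ℤ.* + toℕ k ℤ.+ t)) ≡
      ½ * ↑ (+ fib n ℤ.* (G (1ℤ ℤ.+ t) ℤ.+ G (1ℤ ℤ.+ t) ℤ.- G t))
    ∑-coeff-odd j = trans (∑-coeff (j ℕ.* 2) everyThird) (cong (λ i → ½ * ↑ i) (begin
      -1ℤ ℤ.* -1ℤ ℤ.^ (j ℕ.* 2) ℤ.* trace (j ℕ.* 2) (alternate everyThird)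
        ≡⟨ cong₂ (λ s x → -1ℤ ℤ.* s ℤ.* x) (-1^[m*2]≡1 j)
             (proj₁ (trace-closed j (alternate everyThird) alternate-rec)) ⟩
      -- The inner bracket is 2 Gₜ - Gₜ₊₃, the negative of D G at t; the factor -1 from odd n
      -- cancels that sign.
      -1ℤ ℤ.* 1ℤ ℤ.* (f ℤ.* (1ℤ ℤ.* everyThird 0 ℤ.+ 1ℤ ℤ.* everyThird 0 ℤ.+ -1ℤ ℤ.* everyThird 1))
        ≡⟨ cong₂ (λ x y → -1ℤ ℤ.* 1ℤ ℤ.* (f ℤ.* (1ℤ ℤ.* x ℤ.+ 1ℤ ℤ.* x ℤ.+ -1ℤ ℤ.* y)))
             everyThird-zero (trans (everyThird-suc 0)
               (trans (cong (λ x → G (+ 3 ℤ.+ x)) (ℤ.+-identityˡ t)) (G[3+t] t))) ⟩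
      _
        ≡⟨ collect f (G t) (G (1ℤ ℤ.+ t)) ⟩
      f ℤ.* (G (1ℤ ℤ.+ t) ℤ.+ G (1ℤ ℤ.+ t) ℤ.- G t) ∎))
      where
      open ≡-Reasoning
      f = + fib (suc (j ℕ.* 2))
      collect : ∀ f x y →
        -1ℤ ℤ.* 1ℤ ℤ.* (f ℤ.* (1ℤ ℤ.* x ℤ.+ 1ℤ ℤ.* x ℤ.+ -1ℤ ℤ.* (y ℤ.+ y ℤ.+ x))) ≡
        f ℤ.* (y ℤ.+ y ℤ.- x)
      collect = ℤ-Ring.solve-∀

    -- The case Tₙ = Lₙ: no D is left, so the value is a multiple of `G t` itself.
    ∑-coeff-even : ∀ j → let n = suc (suc (j ℕ.* 2)) in
      ∑[ k ≤ n ] (coeff n (toℕ k) * ↑ G (+ 3 ℤ.* + toℕ k ℤ.+ t)) ≡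
      ½ * ↑ (+ luc n ℤ.* G t)
    ∑-coeff-even j = trans (∑-coeff (suc (j ℕ.* 2)) everyThird) (cong (λ i → ½ * ↑ i) (begin
      -1ℤ ℤ.^ (suc j ℕ.* 2) ℤ.* trace (suc (j ℕ.* 2)) (alternate everyThird)
        ≡⟨ cong₂ ℤ._*_ (-1^[m*2]≡1 (suc j))
             (proj₂ (trace-closed j (alternate everyThird) alternate-rec)) ⟩
      1ℤ ℤ.* (l ℤ.* (1ℤ ℤ.* everyThird 0))
        ≡⟨ collect l (everyThird 0) ⟩
      l ℤ.* everyThird 0
        ≡⟨ cong (l ℤ.*_) everyThird-zero ⟩
      l ℤ.* G t ∎))
      where
      open ≡-Reasoning
      l = + luc (suc (suc (j ℕ.* 2)))
      collect : ∀ l x → 1ℤ ℤ.* (l ℤ.* (1ℤ ℤ.* x)) ≡ l ℤ.* x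
      collect = ℤ-Ring.solve-∀

-- Rational form of the results, and the split by parity.

½*↑[i*j] : ∀ i j → ½ * ↑ (i ℤ.* j) ≡ ½ * ↑ j * ↑ i
½*↑[i*j] i j = begin
  ½ * ↑ (i ℤ.* j)     ≡⟨ cong (λ x → ½ * ↑ x) (ℤ.*-comm i j) ⟩
  ½ * ↑ (j ℤ.* i)     ≡⟨ cong (½ *_) (↑-* j i) ⟩
  ½ * (↑ j * ↑ i)     ≡⟨ ℚ.*-assoc ½ (↑ j) (↑ i) ⟨
  ½ * ↑ j * ↑ i       ∎
  where open ≡-Reasoning

½*↑[i*5j] : ∀ i j → ½ * ↑ (i ℤ.* (+ 5 ℤ.* j)) ≡ (+ 5 / 2) * ↑ j * ↑ i
½*↑[i*5j] i j = begin
  ½ * ↑ (i ℤ.* (+ 5 ℤ.* j))   ≡⟨ ½*↑[i*j] i (+ 5 ℤ.* j) ⟩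
  ½ * ↑ (+ 5 ℤ.* j) * ↑ i     ≡⟨ cong (λ q → ½ * q * ↑ i) (↑-* (+ 5) j) ⟩
  -- After reassociation `½ * ↑ (+ 5)` evaluates to `+ 5 / 2`.
  ½ * (↑ (+ 5) * ↑ j) * ↑ i   ≡⟨ cong (_* ↑ i) (ℚ.*-assoc ½ (↑ (+ 5)) (↑ j)) ⟨
  (+ 5 / 2) * ↑ j * ↑ i       ∎
  where open ≡-Reasoning

even⊎odd : ∀ n → ∃ (λ j → n ≡ j ℕ.* 2) ⊎ ∃ (λ j → n ≡ suc (j ℕ.* 2))
even⊎odd zero    = inj₁ (0 , refl)
even⊎odd (suc n) with even⊎odd n
... | inj₁ (j , n≡) = inj₂ (j , cong suc n≡)
... | inj₂ (j , n≡) = inj₁ (suc j , cong suc n≡)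

2∤n⇒odd : ∀ {n} → 2 ∤ n → ∃ λ j → n ≡ suc (j ℕ.* 2)
2∤n⇒odd {n} 2∤n with even⊎odd n
... | inj₁ (j , n≡) = contradiction (divides j n≡) 2∤n
... | inj₂ odd      = odd

theorem10 : (n : ℕ) .{{_ : NonZero n}} (t : ℤ) →
    let sumL = ∑[ k ≤ n ] (coeff n (toℕ k) * ↑ L (+ 3 ℤ.* + toℕ k ℤ.+ t))
        sumF = ∑[ k ≤ n ] (coeff n (toℕ k) * ↑ F (+ 3 ℤ.* + toℕ k ℤ.+ t))
    in  ((2 ∤ n → sumL ≡ (+ 5 / 2) * ↑ F t * ↑ F (+ n))
       × (2 ∣ n → sumL ≡ ½ * ↑ L t * ↑ L (+ n)))
      × ((2 ∤ n → sumF ≡ ½ * ↑ L t * ↑ F (+ n))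
       × (2 ∣ n → sumF ≡ ½ * ↑ F t * ↑ L (+ n)))
theorem10 n t = (oddL n , evenG L L-fibonacciLike n) , (oddF n , evenG F F-fibonacciLike n)
  where
  oddL : ∀ n .{{_ : NonZero n}} → 2 ∤ n →
    ∑[ k ≤ n ] (coeff n (toℕ k) * ↑ L (+ 3 ℤ.* + toℕ k ℤ.+ t)) ≡ (+ 5 / 2) * ↑ F t * ↑ F (+ n)
  oddL n 2∤n with 2∤n⇒odd 2∤n
  -- The relation D L = 5 F is the source of the factor 5/2.
  ... | j , refl = trans (∑-coeff-odd L L-fibonacciLike t j) (trans
    (cong (λ x → ½ * ↑ (F (+ n) ℤ.* x)) (2L[1+t]-L[t]≡5F[t] t))
    (½*↑[i*5j] (F (+ n)) (F t)))

  oddF : ∀ n .{{_ : NonZero n}} → 2 ∤ n →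
    ∑[ k ≤ n ] (coeff n (toℕ k) * ↑ F (+ 3 ℤ.* + toℕ k ℤ.+ t)) ≡ ½ * ↑ L t * ↑ F (+ n)
  oddF n 2∤n with 2∤n⇒odd 2∤n
  ... | j , refl = trans (∑-coeff-odd F F-fibonacciLike t j) (trans
    (cong (λ x → ½ * ↑ (F (+ n) ℤ.* x)) (2F[1+t]-F[t]≡L[t] t))
    (½*↑[i*j] (F (+ n)) (L t)))

  evenG : ∀ G → FibonacciLike G → ∀ n .{{_ : NonZero n}} → 2 ∣ n →
    ∑[ k ≤ n ] (coeff n (toℕ k) * ↑ G (+ 3 ℤ.* + toℕ k ℤ.+ t)) ≡ ½ * ↑ G t * ↑ L (+ n)
  -- The quotient of `n` by 2 is a successor because `n` is nonzero.
  evenG G G-fib n (divides (suc j) refl) =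
    trans (∑-coeff-even G G-fib t j) (½*↑[i*j] (L (+ n)) (G t))
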